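{- Let $(a)_n=(a_1,\dots,a_n)$ and $(b)_m=(b_1,\dots,b_m)$ be monotonically non-increasing sequences of non-negative integers. Then the random generation algorithm, run on input $(a)_n,(b)_m$, constructs every hypergraph realisation of $(a)_n,(b)_m$ with non-zero probability. That is, for every labelled hypergraph $H=(V,E)$ with $V=\{v_1,\dots,v_n\}$, where $v_i$ has degree $a_i$ for each $i$, and with $m$ edges whose dimensions are $b_1,\dots,b_m$, the probability that the algorithm outputs $H$ is strictly positive.
   Context: A hypergraph $H=(V,E)$ consists of a finite vertex set $V=\{v_1,\dots,v_n\}$ and a finite multiset $E$ of edges, each edge being a subset of $V$. Hypergraphs are labelled. Parallel (repeated) edges are allowed. There are no self-loops: a vertex occurs at most once in an edge. The degree of a vertex is the number of edges (counted with multiplicity) containing it, and the dimension of an edge is its cardinality. Two hypergraphs on the same vertex set are equal if their edge multisets are equal. The conjugate sequence of a sequence $(b)$ whose entries are at most $n$ is $(\bar b)=(\bar b_1,\dots,\bar b_n)$, where $\bar b_i$ is the number of components of $(b)$ that are $\ge i$. Random generation algorithm. The input is a degree sequence $(a)_n$ and a dimension sequence $(b)_m$, both sorted in non-increasing order. Set $(a)^1=(a)_n$, $(b)^1=(b)_m$, $E=\emptyset$. At all times each position of the current degree sequence corresponds to a vertex, initially position $i$ to $v_i$, and this correspondence is carried along when the sequence is sorted (ties broken by a fixed rule). For $j=1,\dots,m$: 1. Write $(a)^j=(a^j_1,\dots,a^j_n)$. Let $b^j_1$ be the first component of $(b)^j$, let $(b)^{j+1}$ be $(b)^j$ with its first component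 removed, and let $(\bar b)^{j+1}=(\bar b^{j+1}_1,\dots,\bar b^{j+1}_n)$ be the conjugate sequence of $(b)^{j+1}$; equivalently, the conjugate of $(b)^j$ with its first $b^j_1$ components reduced by $1$. 2. An index $k\in\{1,\dots,n\}$ is critical if $\sum_{i=1}^k a^j_i>\sum_{i=1}^k \bar b^{j+1}_i$, and its margin of violation is $\sum_{i=1}^k a^j_i-\sum_{i=1}^k\bar b^{j+1}_i$. Let $k^j_1<k^j_2<\cdots$ be all critical indices, with margins $n^j_1,n^j_2,\dots$, and put $k^j_0=0$. Critical indices and margins are computed once, at the start of the iteration. 3. Start with $e_j=\emptyset$. For $i=1,2,\dots$, successively for every critical index $k^j_i$: sample an integer $o_i$ uniformly at random from the integers in $[\max(0,\,n^j_i-|e_j|),\ \min(b^j_1-|e_j|,\ k^j_i-k^j_{i-1})]$, where $e_j$ is the current partial edge; then choose a set $O_i$ of $o_i$ distinct indices uniformly at random from $\{k^j_{i-1}+1,\dots,k^j_i\}$; add the vertices at the positions in $O_i$ to $e_j$, and reduce the components of $(a)^j$ at these positions by $1$. If at some step the interval for $o_i$ contains no integer, the run stops without output. 4. Add $e_j$ to the multiset $E$, and let $(a)^{j+1}$ be the reduced sequence sorted in non-increasing order. All random choices are made independently given the past. The output is $H=(V,E)$ with $E=\{e_1,\dots,e_m\}$ as a multiset. -}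

module Defs where

open import Data.Fin.Base as Fin using (Fin; toℕ)
open import Data.Fin.Permutation as Perm
  using (Permutation′; _⟨$⟩ʳ_; _⟨$⟩ˡ_; _∘ₚ_)
open import Data.Fin.Subset
  using (Subset; inside; outside; _∈_; _⊆_; _∪_; ∣_∣) renaming (⊥ to ∅)
open import Data.Fin.Subset.Properties using (_∈?_; _⊆?_)
open import Data.Bool.Base using (if_then_else_)
import Data.Bool.Properties as Bool
open import Data.Integer.Base as ℤ using (ℤ; +_; 0ℤ; 1ℤ; _⊔_; _⊓_)
import Data.Integer.Properties as ℤ
open import Data.List.Base
  using (List; []; _∷_; [_]; _++_; map; concatMap; filter; foldr; length; take; upTo)
import Data.List.Base as List
open import Data.List.Membership.DecPropositional using () renaming (_∈?_ to ∈-dec)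
open import Data.List.Membership.Propositional.Properties using (∈-∃++)
open import Data.List.Relation.Binary.Permutation.Propositional
  using (_↭_; ↭-refl; ↭-sym; ↭-trans; prep)
open import Data.List.Relation.Binary.Permutation.Propositional.Properties
  using (∈-resp-↭; ¬x∷xs↭[]; drop-∷; shift)
open import Data.List.Relation.Unary.Any using (here)
open import Data.Nat.Base as ℕ using (ℕ; zero; suc)
import Data.Nat.Properties as ℕ
open import Data.Product.Base using (_×_; _,_; proj₁; proj₂; map₂)
open import Data.Rational.Base as ℚ using (ℚ; 0ℚ; 1ℚ; _/_)
open import Data.Vec.Base using (Vec; []; _∷_; lookup; tabulate; toList)
open import Data.Vec.Properties using (≡-dec)
open import Function.Base using (_∘_)
open import Relation.Binary.Definitions using (Antitonic₁; DecidableEquality)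
open import Relation.Binary.PropositionalEquality.Core using (_≡_; refl)
open import Relation.Nullary.Decidable using (Dec; yes; no; does; _×-dec_; map′)
open import Relation.Unary using (Decidable)

private
  variable
    A B : Set
    n m : ℕ

-- Vertex v_i is the i-th element of Fin n.  The list of edges stands for a
-- multiset: two hypergraphs on Fin n are the same when their lists are
-- related by _↭_.

Hypergraph : ℕ → Set
Hypergraph n = List (Subset n)

degree : Hypergraph n → Fin n → ℕ
degree H v = length (filter (v ∈?_) H)

record _Realises_,_ (H : Hypergraph n) (a : Vec ℕ n) (b : Vec ℕ m) : Set where
  field
    degrees    : ∀ v → degree H v ≡ lookup a v
    dimensions : map ∣_∣ H ↭ toList b

_≟ˢ_ : DecidableEquality (Subset n)
_≟ˢ_ = ≡-dec Bool._≟_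

_↭?_ : (G H : Hypergraph n) → Dec (G ↭ H)
[]      ↭? []      = yes ↭-refl
[]      ↭? (e ∷ H) = no (¬x∷xs↭[] ∘ ↭-sym)
(e ∷ G) ↭? H with ∈-dec _≟ˢ_ e H
... | no  e∉H = no λ p → e∉H (∈-resp-↭ p (here refl))
... | yes e∈H with ∈-∃++ e∈H
...   | H₁ , H₂ , refl =
  map′ (λ p → ↭-trans (prep e p) (↭-sym (shift e H₁ H₂)))
       (λ p → drop-∷ (↭-trans p (shift e H₁ H₂)))
       (G ↭? (H₁ ++ H₂))

-- Finitely supported subprobability distributions, as lists of weighted
-- outcomes.  The missing mass is the probability of stopping without output;
-- the same outcome may be listed several times.

Dist : Set → Set
Dist A = List (A × ℚ)

return : A → Dist A
return x = [ x , 1ℚ ]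

infixl 1 _>>=_
_>>=_ : Dist A → (A → Dist B) → Dist B
d >>= f = concatMap (λ (x , p) → map (map₂ (p ℚ.*_)) (f x)) d

-- Uniform over a list without repetitions; stops if there is nothing to
-- choose from.
uniform : List A → Dist A
uniform []           = []
uniform xs@(_ ∷ xs′) = map (_, + 1 / suc (length xs′)) xs

Pr : {P : A → Set} → Decidable P → Dist A → ℚ
Pr P? d = foldr ℚ._+_ 0ℚ (map proj₂ (filter (P? ∘ proj₁) d))

-- The natural numbers in [lo , hi]; for 0 ≤ lo these are all its integers.
interval : ℤ → ℤ → List ℕ
interval lo hi =
  filter (λ o → (lo ℤ.≤? + o) ×-dec (+ o ℤ.≤? hi)) (upTo (suc ℤ.∣ hi ∣))

subsets : ∀ n → List (Subset n)
subsets zero    = [ [] ]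
subsets (suc n) = map (outside ∷_) (subsets n) ++ map (inside ∷_) (subsets n)

-- The positions k′ + 1 , … , k, where position i is the element i - 1 of Fin n.
block : ℕ → ℕ → Subset n
block k′ k = tabulate λ p → does ((k′ ℕ.≤? toℕ p) ×-dec (toℕ p ℕ.<? k))

choices : ℕ → Subset n → List (Subset n)
choices {n} o S = filter (λ O → (O ⊆? S) ×-dec (∣ O ∣ ℕ.≟ o)) (subsets n)

-- Degrees are integers so that reducing a component is never truncated.
DegreeSequence : ℕ → Set
DegreeSequence n = Fin n → ℤ

conjugate : List ℕ → DegreeSequence n
conjugate bs i = + length (filter (suc (toℕ i) ℕ.≤?_) bs)

-- Sum of the first k components.
partialSum : ℕ → DegreeSequence n → ℤ
partialSum k a = foldr ℤ._+_ 0ℤ (take k (List.tabulate a))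

margin : DegreeSequence n → List ℕ → ℕ → ℤ
margin {n} a bs k = partialSum k a ℤ.- partialSum {n} k (conjugate bs)

Critical : DegreeSequence n → List ℕ → ℕ → Set
Critical {n} a bs k = partialSum {n} k (conjugate bs) ℤ.< partialSum k a

critical? : (a : DegreeSequence n) (bs : List ℕ) → Decidable (Critical a bs)
critical? a bs k = _ ℤ.<? _

criticalIndices : DegreeSequence n → List ℕ → List ℕ
criticalIndices {n} a bs = filter (critical? a bs) (map suc (upTo n))

-- A permutation σ used below sends each position to the vertex it
-- corresponds to.

image : Permutation′ n → Subset n → Subset n
image σ O = tabulate λ v → lookup O (σ ⟨$⟩ˡ v)

reduce : Subset n → DegreeSequence n → DegreeSequence n
reduce O a p = if does (p ∈? O) then a p ℤ.- 1ℤ else a p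

-- A deterministic way to sort into non-increasing order.  The result tells
-- which old position moves to each new position; ties may be broken using
-- both the positions and the vertices.
record SortingRule (n : ℕ) : Set where
  field
    order  : Permutation′ n → DegreeSequence n → Permutation′ n
    sorted : ∀ σ a → Antitonic₁ Fin._≤_ ℤ._≤_ (a ∘ (order σ a ⟨$⟩ʳ_))

open SortingRule

-- Arguments: the dimension of the edge, the position-vertex correspondence,
-- the preceding critical index, the remaining critical indices with their
-- margins, and the current partial edge and degree sequence.
fillEdge : ℕ → Permutation′ n → ℕ → List (ℕ × ℤ) →
           Subset n → DegreeSequence n → Dist (Subset n × DegreeSequence n)
fillEdge b σ k′ []             e a = return (e , a)
fillEdge b σ k′ ((k , ν) ∷ ks) e a =
  uniform (interval (0ℤ ⊔ (ν ℤ.- + ∣ e ∣))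
                    ((+ b ℤ.- + ∣ e ∣) ⊓ (+ k ℤ.- + k′))) >>= λ o →
  uniform (choices o (block k′ k)) >>= λ O →
  fillEdge b σ k ks (e ∪ image σ O) (reduce O a)

iterations : SortingRule n → List ℕ → Permutation′ n → DegreeSequence n →
             Dist (Hypergraph n)
iterations rule []       σ a = return []
iterations rule (b ∷ bs) σ a =
  fillEdge b σ 0 (map (λ k → k , margin a bs k) (criticalIndices a bs)) ∅ a
    >>= λ (e , a′) →
  iterations rule bs (order rule σ a′ ∘ₚ σ) (a′ ∘ (order rule σ a′ ⟨$⟩ʳ_))
    >>= λ H →
  return (e ∷ H)

generate : SortingRule n → Vec ℕ n → Vec ℕ m → Dist (Hypergraph n)
generate rule a b = iterations rule (toList b) Perm.id (λ i → + lookup a i)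

{-# OPTIONS --safe #-}

-- Let T be the set of positions of the vertices of the edge that the run
-- should produce next.  Choosing O_i as the part of T in the i-th block is
-- admissible: since the remaining edges realise the reduced degrees, each of
-- them meets the first k positions in at most as many vertices as it
-- contributes to the first k components of the conjugate sequence, so every
-- margin is at most the number of positions of T among the first k.  A
-- nonempty T is exhausted because then n itself is critical.
module Submission where

open import Defs
import Algebra.Properties.AbelianGroup as AbelianGroup
import Algebra.Properties.CommutativeMonoid.Sum as Sum
import Algebra.Properties.CommutativeSemigroup as CommutativeSemigroup
open import Data.Bool.Base using (true; false; if_then_else_; _∨_)
open import Data.Bool.Properties using (∧-zeroʳ)
open import Data.Empty using (⊥; ⊥-elim)
open import Data.Fin.Base as Fin using (Fin; zero; suc; toℕ)
open import Data.Fin.Permutation as Perm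
  using (Permutation′; _⟨$⟩ʳ_; _⟨$⟩ˡ_; _∘ₚ_)
open import Data.Fin.Properties using (toℕ<n; nonZeroIndex)
open import Data.Fin.Subset
  using (Subset; inside; outside; _∈_; _⊆_; _∪_; _∩_; ∣_∣) renaming (⊥ to ∅)
open import Data.Fin.Subset.Properties
open import Data.Integer.Base as ℤ using (ℤ; +_; 0ℤ; 1ℤ; _⊔_; _⊓_)
import Data.Integer.Properties as ℤ
open import Data.List.Base
  using (List; []; _∷_; map; filter; length; upTo)
import Data.List.Membership.Propositional as List
open import Data.List.Membership.Propositional.Properties
  using (∈-filter⁺; ∈-upTo⁺; ∈-++⁺ˡ; ∈-++⁺ʳ; ∈-map⁺)
open import Data.List.Relation.Binary.Permutation.Propositional
  using (_↭_; ↭-sym)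
open import Data.List.Relation.Binary.Permutation.Propositional.Properties
  using (↭-map-inv; filter-↭; ↭-length)
open import Data.List.Relation.Unary.All as All using (All; []; _∷_)
import Data.List.Relation.Unary.All.Properties as All
open import Data.List.Relation.Unary.AllPairs using (AllPairs; []; _∷_)
import Data.List.Relation.Unary.AllPairs.Properties as AllPairs
open import Data.List.Relation.Unary.Any as Any using (Any; here; there)
import Data.List.Relation.Unary.Any.Properties as Any
open import Data.Nat.Base as ℕ using (ℕ; zero; suc; s≤s; z≤n)
import Data.Nat.Properties as ℕ
open import Data.Product.Base using (_×_; _,_; proj₁; proj₂)
open import Data.Rational.Base as ℚ using (ℚ; 0ℚ; Positive)
import Data.Rational.Properties as ℚ
open import Data.Sum.Base using (inj₁; inj₂)
open import Data.Vec.Base using (Vec; []; _∷_; here; there; lookup; tabulate)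
open import Data.Vec.Properties
  using (lookup∘tabulate; tabulate∘lookup; tabulate-cong; lookup-zipWith; lookup-replicate;
         []=⇒lookup; lookup⇒[]=)
open import Function.Base using (_∘_; case_of_)
open import Relation.Binary.Definitions using (Antitonic₁)
open import Relation.Binary.PropositionalEquality
  using (_≡_; refl; sym; trans; cong; cong₂; subst; module ≡-Reasoning)
open import Relation.Nullary.Decidable
  using (yes; no; does; _×-dec_; dec-true; dec-false)
open import Relation.Nullary.Negation using (contradiction)
open import Relation.Unary using (Decidable)

open SortingRule using (order)

private
  variable
    A B : Set
    n : ℕ

-- Distributions

-- Support without weights: a run can be exhibited by its choices alone, while `AllPositive` takes
-- care of the probabilities once and for all.
Possible : (A → Set) → Dist A → Set
Possible P = Any (P ∘ proj₁)

AllPositive : Dist A → Set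
AllPositive = All (Positive ∘ proj₂)

Possible-return : {P : A → Set} {x : A} → P x → Possible P (return x)
Possible-return = here

Possible->>= : {P : B → Set} {d : Dist A} {f : A → Dist B} →
               Possible (Possible P ∘ f) d → Possible P (d >>= f)
Possible->>= = Any.concatMap⁺ _ ∘ Any.map Any.map⁺

Possible-uniform : {P : A → Set} {xs : List A} → Any P xs → Possible P (uniform xs)
Possible-uniform {xs = _ ∷ _} = Any.map⁺

AllPositive-return : {x : A} → AllPositive (return x)
AllPositive-return = _ ∷ []

AllPositive->>= : {d : Dist A} {f : A → Dist B} →
                  AllPositive d → (∀ x → AllPositive (f x)) → AllPositive (d >>= f)
AllPositive->>= []                            pf = []
AllPositive->>= {d = (x , p) ∷ d} (p>0 ∷ d>0) pf = All.++⁺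
  (All.map⁺ (All.map (λ {(_ , q)} q>0 → ℚ.pos*pos⇒pos p {{p>0}} q {{q>0}}) (pf x)))
  (AllPositive->>= d>0 pf)

AllPositive-uniform : (xs : List A) → AllPositive (uniform xs)
AllPositive-uniform []             = []
AllPositive-uniform xs@(_ ∷ xs′) =
  All.map⁺ (All.universal (λ _ → ℚ.normalize-pos 1 (suc (length xs′))) xs)

module _ {P : A → Set} (P? : Decidable P) where

  Pr-nonNegative : {d : Dist A} → AllPositive d → 0ℚ ℚ.≤ Pr P? d
  Pr-nonNegative []                          = ℚ.≤-refl
  Pr-nonNegative {(x , p) ∷ d} (p>0 ∷ d>0) with P? x
  ... | yes _ = ℚ.+-mono-≤ (ℚ.<⇒≤ (ℚ.positive⁻¹ p {{p>0}})) (Pr-nonNegative d>0)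
  ... | no  _ = Pr-nonNegative d>0

  -- With all weights positive nothing can cancel, so a single listed outcome in `P` is enough.
  Pr-positive : {d : Dist A} → AllPositive d → Possible P d → 0ℚ ℚ.< Pr P? d
  Pr-positive {(x , p) ∷ d} (p>0 ∷ d>0) d∋P with P? x | d∋P
  -- The head already contributes a strictly positive term, wherever the given witness lies.
  ... | yes _  | _           = ℚ.+-mono-<-≤ (ℚ.positive⁻¹ p {{p>0}}) (Pr-nonNegative d>0)
  ... | no ¬Px | here Px     = contradiction Px ¬Px
  ... | no _   | there d∋P′ = Pr-positive d>0 d∋P′

-- Positivity of the weights in the algorithm

AllPositive-fillEdge : ∀ b (σ : Permutation′ n) k′ ks e a →
                       AllPositive (fillEdge b σ k′ ks e a)
AllPositive-fillEdge b σ k′ []             e a = AllPositive-return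
AllPositive-fillEdge b σ k′ ((k , ν) ∷ ks) e a =
  AllPositive->>= (AllPositive-uniform (interval (0ℤ ⊔ (ν ℤ.- + ∣ e ∣))
                                                 ((+ b ℤ.- + ∣ e ∣) ⊓ (+ k ℤ.- + k′)))) λ o →
  AllPositive->>= (AllPositive-uniform (choices o (block k′ k))) λ O →
  AllPositive-fillEdge b σ k ks (e ∪ image σ O) (reduce O a)

AllPositive-iterations : ∀ (rule : SortingRule n) bs σ a →
                         AllPositive (iterations rule bs σ a)
AllPositive-iterations rule []       σ a = AllPositive-return
AllPositive-iterations rule (b ∷ bs) σ a =
  AllPositive->>= (AllPositive-fillEdge b σ 0 (map (λ k → k , margin a bs k)
                                                    (criticalIndices a bs)) ∅ a) λ (_ , a′) →
  AllPositive->>= (AllPositive-iterations rule bs (order rule σ a′ ∘ₚ σ)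
                                                  (a′ ∘ (order rule σ a′ ⟨$⟩ʳ_))) λ _ →
  AllPositive-return

-- Subsets

-- Connects `χ` and `degree`, which test membership, with `image` and `block`, which are tabulated
-- Booleans.
does-∈? : ∀ (S : Subset n) p → does (p ∈? S) ≡ lookup S p
does-∈? (inside  ∷ S) zero    = refl
does-∈? (outside ∷ S) zero    = refl
does-∈? (_       ∷ S) (suc p) = does-∈? S p

∣p∪q∣≡∣p∣+∣q∣ : ∀ (p q : Subset n) → (∀ {x} → x ∈ p → x ∈ q → ⊥) →
                ∣ p ∪ q ∣ ≡ ∣ p ∣ ℕ.+ ∣ q ∣
∣p∪q∣≡∣p∣+∣q∣ []            []            _ = refl
∣p∪q∣≡∣p∣+∣q∣ (inside  ∷ p) (inside  ∷ q) d = ⊥-elim (d here here)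
∣p∪q∣≡∣p∣+∣q∣ (inside  ∷ p) (outside ∷ q) d =
  cong suc (∣p∪q∣≡∣p∣+∣q∣ p q λ x∈p x∈q → d (there x∈p) (there x∈q))
∣p∪q∣≡∣p∣+∣q∣ (outside ∷ p) (inside  ∷ q) d =
  trans (cong suc (∣p∪q∣≡∣p∣+∣q∣ p q λ x∈p x∈q → d (there x∈p) (there x∈q)))
        (sym (ℕ.+-suc _ _))
∣p∪q∣≡∣p∣+∣q∣ (outside ∷ p) (outside ∷ q) d =
  ∣p∪q∣≡∣p∣+∣q∣ p q λ x∈p x∈q → d (there x∈p) (there x∈q)

∈-subsets : (S : Subset n) → S List.∈ subsets n
∈-subsets []            = here refl
∈-subsets (outside ∷ S) = ∈-++⁺ˡ (∈-map⁺ (outside ∷_) (∈-subsets S))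
∈-subsets (inside  ∷ S) = ∈-++⁺ʳ (map (outside ∷_) (subsets _)) (∈-map⁺ (inside ∷_) (∈-subsets S))

-- Transport between positions and vertices

lookup-image : ∀ (σ : Permutation′ n) S v → lookup (image σ S) v ≡ lookup S (σ ⟨$⟩ˡ v)
lookup-image σ S v = lookup∘tabulate (λ w → lookup S (σ ⟨$⟩ˡ w)) v

image-∪ : ∀ (σ : Permutation′ n) p q → image σ (p ∪ q) ≡ image σ p ∪ image σ q
image-∪ σ p q = begin
  image σ (p ∪ q)                             ≡⟨ tabulate-cong eq ⟩
  tabulate (lookup (image σ p ∪ image σ q))   ≡⟨ tabulate∘lookup _ ⟩
  image σ p ∪ image σ q                       ∎
  where
  open ≡-Reasoning
  eq : ∀ v → lookup (p ∪ q) (σ ⟨$⟩ˡ v) ≡ lookup (image σ p ∪ image σ q) v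
  eq v = begin
    lookup (p ∪ q) (σ ⟨$⟩ˡ v)
      ≡⟨ lookup-zipWith _∨_ (σ ⟨$⟩ˡ v) p q ⟩
    lookup p (σ ⟨$⟩ˡ v) ∨ lookup q (σ ⟨$⟩ˡ v)
      ≡⟨ cong₂ _∨_ (lookup-image σ p v) (lookup-image σ q v) ⟨
    lookup (image σ p) v ∨ lookup (image σ q) v
      ≡⟨ lookup-zipWith _∨_ v (image σ p) (image σ q) ⟨
    lookup (image σ p ∪ image σ q) v
      ∎

image-∅ : (σ : Permutation′ n) → image σ ∅ ≡ ∅
image-∅ σ = trans (tabulate-cong λ v → trans (lookup-replicate (σ ⟨$⟩ˡ v) outside)
                                              (sym (lookup-replicate v outside)))
                  (tabulate∘lookup ∅)

-- `image (Perm.flip σ) e` is the set of positions whose vertices lie in `e`; choosing exactly these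
-- positions therefore gives back the edge `e`.
image-flip : ∀ (σ : Permutation′ n) e → image σ (image (Perm.flip σ) e) ≡ e
image-flip σ e = trans (tabulate-cong eq) (tabulate∘lookup e)
  where
  eq : ∀ v → lookup (image (Perm.flip σ) e) (σ ⟨$⟩ˡ v) ≡ lookup e v
  eq v = trans (lookup-image (Perm.flip σ) e (σ ⟨$⟩ˡ v)) (cong (lookup e) (Perm.inverseʳ σ))

open CommutativeSemigroup ℤ.+-commutativeSemigroup using (interchange)
open AbelianGroup ℤ.+-0-abelianGroup using (xyx⁻¹≈y)
open Sum ℕ.+-0-commutativeMonoid using (sum; sum-permute; sum-cong-≗)

-- In this form the invariance of cardinality under `image` is an instance of `sum-permute`.
∣p∣≡sum : (S : Subset n) → ∣ S ∣ ≡ sum (λ p → if lookup S p then 1 else 0)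
∣p∣≡sum []            = refl
∣p∣≡sum (inside  ∷ S) = cong suc (∣p∣≡sum S)
∣p∣≡sum (outside ∷ S) = ∣p∣≡sum S

∣image∣ : ∀ (σ : Permutation′ n) S → ∣ image σ S ∣ ≡ ∣ S ∣
∣image∣ σ S = begin
  ∣ image σ S ∣
    ≡⟨ ∣p∣≡sum (image σ S) ⟩
  sum (λ v → if lookup (image σ S) v then 1 else 0)
    ≡⟨ sum-cong-≗ (λ v → cong (if_then 1 else 0) (lookup-image σ S v)) ⟩
  sum (λ v → if lookup S (σ ⟨$⟩ˡ v) then 1 else 0)
    ≡⟨ sum-permute (λ p → if lookup S p then 1 else 0) (Perm.flip σ) ⟨
  sum (λ p → if lookup S p then 1 else 0)
    ≡⟨ ∣p∣≡sum S ⟨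
  ∣ S ∣
    ∎
  where open ≡-Reasoning

-- Blocks

lookup-block : ∀ k′ k (p : Fin n) →
               lookup (block k′ k) p ≡ does ((k′ ℕ.≤? toℕ p) ×-dec (toℕ p ℕ.<? k))
lookup-block k′ k p =
  lookup∘tabulate (λ q → does ((k′ ℕ.≤? toℕ q) ×-dec (toℕ q ℕ.<? k))) p

∈-block⁺ : ∀ k′ k {p : Fin n} → k′ ℕ.≤ toℕ p → toℕ p ℕ.< k → p ∈ block k′ k
∈-block⁺ k′ k {p} k′≤p p<k = lookup⇒[]= p (block k′ k)
  (trans (lookup-block k′ k p)
         (dec-true ((k′ ℕ.≤? toℕ p) ×-dec (toℕ p ℕ.<? k)) (k′≤p , p<k)))

∈-block⁻ : ∀ k′ k {p : Fin n} → p ∈ block k′ k → k′ ℕ.≤ toℕ p × toℕ p ℕ.< k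
∈-block⁻ k′ k {p} p∈ with (k′ ℕ.≤? toℕ p) ×-dec (toℕ p ℕ.<? k) in eq
... | yes r = r
... | no  _ with () ← trans (sym ([]=⇒lookup p∈)) (trans (lookup-block k′ k p) (cong does eq))

-- Blocks are half-open in the numbering from 0, so the first ends where the second begins. This is
-- how the part of an edge already chosen is extended by the next block.
block-∪ : ∀ {k′ k} → k′ ℕ.≤ k → block {n} 0 k′ ∪ block k′ k ≡ block 0 k
block-∪ {k′ = k′} {k} k′≤k = ⊆-antisym to from
  where
  to : block 0 k′ ∪ block k′ k ⊆ block 0 k
  to p∈ with x∈p∪q⁻ (block 0 k′) (block k′ k) p∈
  ... | inj₁ p∈₁ = ∈-block⁺ 0 k z≤n (ℕ.<-≤-trans (proj₂ (∈-block⁻ 0 k′ p∈₁)) k′≤k)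
  ... | inj₂ p∈₂ = ∈-block⁺ 0 k z≤n (proj₂ (∈-block⁻ k′ k p∈₂))
  from : block 0 k ⊆ block 0 k′ ∪ block k′ k
  from {p} p∈ with toℕ p ℕ.<? k′
  ... | yes p<k′ = x∈p∪q⁺ (inj₁ (∈-block⁺ 0 k′ z≤n p<k′))
  ... | no  p≮k′ = x∈p∪q⁺ (inj₂ (∈-block⁺ k′ k (ℕ.≮⇒≥ p≮k′) (proj₂ (∈-block⁻ 0 k p∈))))

∩-block-∪ : ∀ (T : Subset n) {k′ k} → k′ ℕ.≤ k →
            (T ∩ block 0 k′) ∪ (T ∩ block k′ k) ≡ T ∩ block 0 k
∩-block-∪ T {k′} {k} k′≤k =
  trans (sym (∩-distribˡ-∪ T (block 0 k′) (block k′ k))) (cong (T ∩_) (block-∪ k′≤k))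

∩-block-disjoint : ∀ (T : Subset n) k′ k {p} →
                   p ∈ T ∩ block 0 k′ → p ∈ T ∩ block k′ k → ⊥
∩-block-disjoint T k′ k p∈₁ p∈₂ = ℕ.<⇒≱
  (proj₂ (∈-block⁻ 0 k′ (proj₂ (x∈p∩q⁻ T (block 0 k′) p∈₁))))
  (proj₁ (∈-block⁻ k′ k (proj₂ (x∈p∩q⁻ T (block k′ k) p∈₂))))

∣∩-block∣ : ∀ (T : Subset n) {k′ k} → k′ ℕ.≤ k →
            ∣ T ∩ block 0 k ∣ ≡ ∣ T ∩ block 0 k′ ∣ ℕ.+ ∣ T ∩ block k′ k ∣
∣∩-block∣ T {k′} {k} k′≤k = trans (cong ∣_∣ (sym (∩-block-∪ T k′≤k)))
  (∣p∪q∣≡∣p∣+∣q∣ (T ∩ block 0 k′) (T ∩ block k′ k) (∩-block-disjoint T k′ k))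

∩-block-full : ∀ (T : Subset n) k → (∀ {p} → p ∈ T → toℕ p ℕ.< k) → T ∩ block 0 k ≡ T
∩-block-full T k T<k = ⊆-antisym (p∩q⊆p T (block 0 k))
  λ p∈T → x∈p∩q⁺ (p∈T , ∈-block⁺ 0 k z≤n (T<k p∈T))

∩-block-empty : ∀ (T : Subset n) → T ∩ block 0 0 ≡ ∅
∩-block-empty []      = refl
∩-block-empty (x ∷ T) = cong₂ _∷_ (∧-zeroʳ x) (∩-block-empty T)

∣∩-block-empty∣ : ∀ (T : Subset n) → ∣ T ∩ block 0 0 ∣ ≡ 0
∣∩-block-empty∣ {n} T = trans (cong ∣_∣ (∩-block-empty T)) (∣⊥∣≡0 n)

-- The contribution of one edge of dimension `b` to the first `k` components of the conjugate
-- sequence. The minimum includes `n` because neither `b` nor `k` is bounded by it here.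
∣block-0∩block-0∣ : ∀ n b k → ∣ block {n} 0 b ∩ block 0 k ∣ ≡ n ℕ.⊓ (b ℕ.⊓ k)
∣block-0∩block-0∣ zero    b       k       = refl
∣block-0∩block-0∣ (suc n) zero    k       =
  trans (cong ∣_∣ (∩-comm (block {suc n} 0 0) (block 0 k))) (∣∩-block-empty∣ (block {suc n} 0 k))
∣block-0∩block-0∣ (suc n) (suc b) zero    = ∣∩-block-empty∣ (block {suc n} 0 (suc b))
∣block-0∩block-0∣ (suc n) (suc b) (suc k) = cong suc (∣block-0∩block-0∣ n b k)

block-suc : ∀ n k′ k → block {suc n} (suc k′) (suc k) ≡ outside ∷ block k′ k
-- The comparison with `k′` computes only once `k′` is known to be zero or a successor.
block-suc n zero     k = refl
block-suc n (suc k′) k = refl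

-- Only an inequality, since a block reaching beyond `n` is cut off there.
∣block∣≤ : ∀ n {k′ k} → k′ ℕ.≤ k → ∣ block {n} k′ k ∣ ℕ.≤ k ℕ.∸ k′
∣block∣≤ zero    _                     = z≤n
∣block∣≤ (suc n) (z≤n {zero})          = ∣block∣≤ n {0} z≤n
∣block∣≤ (suc n) (z≤n {suc k})         = s≤s (∣block∣≤ n z≤n)
∣block∣≤ (suc n) (s≤s {k′} {k} k′≤k) =
  subst (λ S → ∣ S ∣ ℕ.≤ k ℕ.∸ k′) (sym (block-suc n k′ k)) (∣block∣≤ n k′≤k)

-- Partial sums

-- Adding an edge adds such an indicator to both sequences that a margin compares: that of its set
-- of positions to the degrees, that of an initial block to the conjugate sequence.
χ : Subset n → DegreeSequence n
χ S p = if does (p ∈? S) then 1ℤ else 0ℤ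

partialSum-cong : ∀ k {a a′ : DegreeSequence n} → (∀ p → a p ≡ a′ p) →
                  partialSum k a ≡ partialSum k a′
partialSum-cong zero            eq = refl
partialSum-cong {zero}  (suc k) eq = refl
partialSum-cong {suc n} (suc k) eq =
  cong₂ ℤ._+_ (eq zero) (partialSum-cong k (eq ∘ suc))

partialSum-+ : ∀ k (a a′ : DegreeSequence n) →
               partialSum k (λ p → a p ℤ.+ a′ p) ≡ partialSum k a ℤ.+ partialSum k a′
partialSum-+ zero            a a′ = refl
partialSum-+ {zero}  (suc k) a a′ = refl
partialSum-+ {suc n} (suc k) a a′ =
  trans (cong (ℤ._+_ (a zero ℤ.+ a′ zero)) (partialSum-+ k (a ∘ suc) (a′ ∘ suc)))
        (interchange (a zero) (a′ zero) _ _)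

partialSum-χ : ∀ k (S : Subset n) → partialSum k (χ S) ≡ + ∣ S ∩ block 0 k ∣
partialSum-χ zero    S             = cong +_ (sym (∣∩-block-empty∣ S))
partialSum-χ (suc k) []            = refl
partialSum-χ (suc k) (inside  ∷ S) = cong (ℤ._+_ 1ℤ) (partialSum-χ k S)
partialSum-χ (suc k) (outside ∷ S) = cong (ℤ._+_ 0ℤ) (partialSum-χ k S)

-- Degrees and components of the conjugate sequence are both counts made by `filter`, so one
-- recursion serves for both.
length-filter-∷ : {P : A → Set} (P? : Decidable P) (x : A) (xs : List A) →
  + length (filter P? (x ∷ xs)) ≡
  (if does (P? x) then 1ℤ else 0ℤ) ℤ.+ + length (filter P? xs)
length-filter-∷ P? x xs with does (P? x)
... | true  = refl
... | false = refl

degree-∷ : ∀ (σ : Permutation′ n) e H p →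
  + degree (e ∷ H) (σ ⟨$⟩ʳ p) ≡ χ (image (Perm.flip σ) e) p ℤ.+ + degree H (σ ⟨$⟩ʳ p)
degree-∷ σ e H p = trans (length-filter-∷ (σ ⟨$⟩ʳ p ∈?_) e H)
  (cong (λ c → (if c then 1ℤ else 0ℤ) ℤ.+ + degree H (σ ⟨$⟩ʳ p)) eq)
  where
  eq : does (σ ⟨$⟩ʳ p ∈? e) ≡ does (p ∈? image (Perm.flip σ) e)
  eq = trans (does-∈? e (σ ⟨$⟩ʳ p))
      (trans (sym (lookup-image (Perm.flip σ) e p)) (sym (does-∈? (image (Perm.flip σ) e) p)))

conjugate-∷ : ∀ b bs (p : Fin n) →
  conjugate (b ∷ bs) p ≡ χ (block 0 b) p ℤ.+ conjugate bs p
conjugate-∷ b bs p = trans (length-filter-∷ (suc (toℕ p) ℕ.≤?_) b bs)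
  (cong (λ c → (if c then 1ℤ else 0ℤ) ℤ.+ conjugate bs p)
        -- The test `0 ≤? toℕ p` computes to true, and `toℕ p <? b` is by definition
        -- `suc (toℕ p) ≤? b`, the test in `conjugate`.
        (sym (trans (does-∈? (block 0 b) p) (lookup-block 0 b p))))

partialSum-degree-∷ : ∀ k (σ : Permutation′ n) e H →
  partialSum k (λ p → + degree (e ∷ H) (σ ⟨$⟩ʳ p)) ≡
  + ∣ image (Perm.flip σ) e ∩ block 0 k ∣ ℤ.+ partialSum k (λ p → + degree H (σ ⟨$⟩ʳ p))
partialSum-degree-∷ k σ e H = begin
  partialSum k (λ p → + degree (e ∷ H) (σ ⟨$⟩ʳ p))
    ≡⟨ partialSum-cong k (degree-∷ σ e H) ⟩
  partialSum k (λ p → χ T p ℤ.+ d p)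
    ≡⟨ partialSum-+ k (χ T) d ⟩
  partialSum k (χ T) ℤ.+ partialSum k d
    ≡⟨ cong (ℤ._+ partialSum k d) (partialSum-χ k T) ⟩
  + ∣ T ∩ block 0 k ∣ ℤ.+ partialSum k d
    ∎
  where
  open ≡-Reasoning
  T = image (Perm.flip σ) e
  d : DegreeSequence _
  d p = + degree H (σ ⟨$⟩ʳ p)

partialSum-conjugate-∷ : ∀ {n} k b bs →
  partialSum {n} k (conjugate (b ∷ bs)) ≡
  + (n ℕ.⊓ (b ℕ.⊓ k)) ℤ.+ partialSum {n} k (conjugate bs)
partialSum-conjugate-∷ {n} k b bs = begin
  partialSum {n} k (conjugate (b ∷ bs))
    ≡⟨ partialSum-cong k (conjugate-∷ b bs) ⟩
  partialSum {n} k (λ p → χ (block 0 b) p ℤ.+ conjugate bs p)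
    ≡⟨ partialSum-+ {n} k (χ (block 0 b)) (conjugate bs) ⟩
  partialSum {n} k (χ (block 0 b)) ℤ.+ partialSum {n} k (conjugate bs)
    ≡⟨ cong (ℤ._+ partialSum {n} k (conjugate bs))
         (trans (partialSum-χ {n} k (block 0 b)) (cong +_ (∣block-0∩block-0∣ n b k))) ⟩
  + (n ℕ.⊓ (b ℕ.⊓ k)) ℤ.+ partialSum {n} k (conjugate bs)
    ∎
  where open ≡-Reasoning

-- Among the sets of a given size, an initial block has the most elements in the first `k`
-- positions; the bound is the value for `block 0 ∣ T ∣`.
∣∩-block∣≤ : ∀ {n} (T : Subset n) k → ∣ T ∩ block 0 k ∣ ℕ.≤ n ℕ.⊓ (∣ T ∣ ℕ.⊓ k)
∣∩-block∣≤ {n} T k = ℕ.⊓-glb (∣p∣≤n (T ∩ block 0 k))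
  (ℕ.⊓-glb (∣p∩q∣≤∣p∣ T (block 0 k))
           (ℕ.≤-trans (∣p∩q∣≤∣q∣ T (block 0 k)) (∣block∣≤ n z≤n)))

-- The easy direction of the Gale–Ryser theorem, for an arbitrary order of
-- the vertices.
degree≤conjugate : ∀ {n} k (σ : Permutation′ n) H →
  partialSum k (λ p → + degree H (σ ⟨$⟩ʳ p)) ℤ.≤ partialSum {n} k (conjugate (map ∣_∣ H))
degree≤conjugate     k σ []      = ℤ.≤-refl
degree≤conjugate {n} k σ (e ∷ H) = begin
  partialSum k (λ p → + degree (e ∷ H) (σ ⟨$⟩ʳ p))
    ≡⟨ partialSum-degree-∷ k σ e H ⟩
  + ∣ T ∩ block 0 k ∣ ℤ.+ partialSum k (λ p → + degree H (σ ⟨$⟩ʳ p))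
    ≤⟨ ℤ.+-mono-≤ (ℤ.+≤+ (∣∩-block∣≤ T k)) (degree≤conjugate k σ H) ⟩
  + (n ℕ.⊓ (∣ T ∣ ℕ.⊓ k)) ℤ.+ partialSum {n} k (conjugate (map ∣_∣ H))
    ≡⟨ cong (λ b → + (n ℕ.⊓ (b ℕ.⊓ k)) ℤ.+ partialSum {n} k (conjugate (map ∣_∣ H)))
            (∣image∣ (Perm.flip σ) e) ⟩
  + (n ℕ.⊓ (∣ e ∣ ℕ.⊓ k)) ℤ.+ partialSum {n} k (conjugate (map ∣_∣ H))
    ≡⟨ partialSum-conjugate-∷ k ∣ e ∣ (map ∣_∣ H) ⟨
  partialSum {n} k (conjugate (map ∣_∣ (e ∷ H)))
    ∎
  where
  open ℤ.≤-Reasoning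
  T = image (Perm.flip σ) e

-- At `k = n` both sums count all incidences of vertices and edges. This direction is the one that
-- makes `n` critical when the next edge is nonempty.
conjugate≤degree : ∀ {n} (σ : Permutation′ n) H →
  partialSum {n} n (conjugate (map ∣_∣ H)) ℤ.≤ partialSum n (λ p → + degree H (σ ⟨$⟩ʳ p))
conjugate≤degree     σ []      = ℤ.≤-refl
conjugate≤degree {n} σ (e ∷ H) = begin
  partialSum {n} n (conjugate (map ∣_∣ (e ∷ H)))
    ≡⟨ partialSum-conjugate-∷ n ∣ e ∣ (map ∣_∣ H) ⟩
  + (n ℕ.⊓ (∣ e ∣ ℕ.⊓ n)) ℤ.+ partialSum {n} n (conjugate (map ∣_∣ H))
    ≤⟨ ℤ.+-mono-≤ (ℤ.+≤+ (ℕ.≤-trans (ℕ.m⊓n≤n n _) (ℕ.m⊓n≤m ∣ e ∣ n))) (conjugate≤degree σ H) ⟩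
  + ∣ e ∣ ℤ.+ partialSum n (λ p → + degree H (σ ⟨$⟩ʳ p))
    ≡⟨ cong (λ b → + b ℤ.+ partialSum n (λ p → + degree H (σ ⟨$⟩ʳ p))) (∣image∣ (Perm.flip σ) e) ⟨
  + ∣ T ∣ ℤ.+ partialSum n (λ p → + degree H (σ ⟨$⟩ʳ p))
    ≡⟨ cong (λ S → + ∣ S ∣ ℤ.+ partialSum n (λ p → + degree H (σ ⟨$⟩ʳ p)))
            (∩-block-full T n (λ {p} _ → toℕ<n p)) ⟨
  + ∣ T ∩ block 0 n ∣ ℤ.+ partialSum n (λ p → + degree H (σ ⟨$⟩ʳ p))
    ≡⟨ partialSum-degree-∷ n σ e H ⟨
  partialSum n (λ p → + degree (e ∷ H) (σ ⟨$⟩ʳ p))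
    ∎
  where
  open ℤ.≤-Reasoning
  T = image (Perm.flip σ) e

-- Runs producing a given hypergraph

∈-interval⁺ : ∀ {lo hi o} → lo ℤ.≤ + o → + o ℤ.≤ hi → o List.∈ interval lo hi
-- Matching on `ℤ.+≤+` shows that `hi` is a natural number, so the range bound `∣ hi ∣` in
-- `interval` loses nothing.
∈-interval⁺ {lo} {hi} {o} lo≤o o≤hi@(ℤ.+≤+ o≤) =
  ∈-filter⁺ (λ o → (lo ℤ.≤? + o) ×-dec (+ o ℤ.≤? hi)) (∈-upTo⁺ (s≤s o≤)) (lo≤o , o≤hi)

∈-choices⁺ : ∀ {O S : Subset n} → O ⊆ S → O List.∈ choices ∣ O ∣ S
∈-choices⁺ {O = O} {S} O⊆S =
  ∈-filter⁺ (λ O′ → (O′ ⊆? S) ×-dec (∣ O′ ∣ ℕ.≟ ∣ O ∣)) (∈-subsets O) (O⊆S , refl)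

j≤i+k⇒j-i≤k : ∀ i {j k} → j ℤ.≤ i ℤ.+ k → j ℤ.- i ℤ.≤ k
j≤i+k⇒j-i≤k i {j} {k} j≤i+k = begin
  j ℤ.- i         ≤⟨ ℤ.+-monoˡ-≤ (ℤ.- i) j≤i+k ⟩
  i ℤ.+ k ℤ.- i   ≡⟨ xyx⁻¹≈y i k ⟩
  k               ∎
  where open ℤ.≤-Reasoning

i+k≤j⇒k≤j-i : ∀ i {j k} → i ℤ.+ k ℤ.≤ j → k ℤ.≤ j ℤ.- i
i+k≤j⇒k≤j-i i {j} {k} i+k≤j = begin
  k               ≡⟨ xyx⁻¹≈y i k ⟨
  i ℤ.+ k ℤ.- i   ≤⟨ ℤ.+-monoˡ-≤ (ℤ.- i) i+k≤j ⟩
  j ℤ.- i         ∎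
  where open ℤ.≤-Reasoning

reduce-χ : ∀ S (a : DegreeSequence n) p → reduce S a p ≡ a p ℤ.- χ S p
reduce-χ S a p with does (p ∈? S)
... | true  = refl
... | false = sym (ℤ.+-identityʳ (a p))

reduce-∅ : ∀ (a : DegreeSequence n) p → reduce ∅ a p ≡ a p
reduce-∅ a p = cong (if_then a p ℤ.- 1ℤ else a p) (dec-false (p ∈? ∅) ∉⊥)

reduce-cong : ∀ S {a a′ : DegreeSequence n} → (∀ p → a p ≡ a′ p) →
              ∀ p → reduce S a p ≡ reduce S a′ p
reduce-cong S eq p = cong (λ x → if does (p ∈? S) then x ℤ.- 1ℤ else x) (eq p)

-- A common position would be lowered twice on the left but once on the right, whence the
-- disjointness.
reduce-∪ : ∀ S S′ → (∀ {p : Fin n} → p ∈ S → p ∈ S′ → ⊥) →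
           ∀ a p → reduce S′ (reduce S a) p ≡ reduce (S ∪ S′) a p
reduce-∪ S S′ disjoint a p with p ∈? S | p ∈? S′ | p ∈? (S ∪ S′)
... | yes p∈S | yes p∈S′ | _      = ⊥-elim (disjoint p∈S p∈S′)
... | yes p∈S | no  _    | yes _  = refl
... | no  _   | yes _    | yes _  = refl
... | no  _   | no  _    | no _   = refl
... | yes p∈S | no  _    | no p∉  = contradiction (x∈p∪q⁺ (inj₁ p∈S)) p∉
... | no  _   | yes p∈S′ | no p∉  = contradiction (x∈p∪q⁺ (inj₂ p∈S′)) p∉
... | no p∉S  | no  p∉S′ | yes p∈ with x∈p∪q⁻ S S′ p∈
...   | inj₁ p∈S  = contradiction p∈S p∉S
...   | inj₂ p∈S′ = contradiction p∈S′ p∉S′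

-- Filling an edge with a prescribed set of positions

module _ (σ : Permutation′ n) (T : Subset n) (a₀ : DegreeSequence n) (ν : ℕ → ℤ)
         (ν≤ : ∀ k → ν k ℤ.≤ + ∣ T ∩ block 0 k ∣) where

  -- Induction on the critical indices still to come, `k′` being the last one handled: `e` and `a`
  -- reflect exactly the part of `T` among the first `k′` positions, and no position of `T` lies
  -- beyond all the indices. The margins `ν` are fixed throughout, as they are computed before any
  -- reduction.
  fillEdge-possible : ∀ k′ ks e a → AllPairs ℕ._<_ (k′ ∷ ks) →
    (∀ {p} → p ∈ T → Any (toℕ p ℕ.<_) (k′ ∷ ks)) →
    e ≡ image σ (T ∩ block 0 k′) →
    (∀ p → a p ≡ reduce (T ∩ block 0 k′) a₀ p) →
    Possible (λ (e′ , a′) → e′ ≡ image σ T × (∀ p → a′ p ≡ reduce T a₀ p))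
             (fillEdge ∣ T ∣ σ k′ (map (λ k → k , ν k) ks) e a)
  fillEdge-possible k′ [] e a _ T< e≡ a≡ = Possible-return
    (trans e≡ (cong (image σ) T∩≡T) ,
     λ p → trans (a≡ p) (cong (λ S → reduce S a₀ p) T∩≡T))
    where
    T∩≡T : T ∩ block 0 k′ ≡ T
    -- With no index left, `k′` itself must bound every position of `T`.
    T∩≡T = ∩-block-full T k′ λ p∈T → case T< p∈T of λ { (here p<k′) → p<k′ }
  fillEdge-possible k′ (k ∷ ks) e a ((k′<k ∷ _) ∷ ks<) T< e≡ a≡ =
    Possible->>= {d = uniform (interval lo hi)}
      (Possible-uniform (List.lose (∈-interval⁺ lo≤∣O∣ ∣O∣≤hi)
    (Possible->>= {d = uniform (choices ∣ O ∣ (block k′ k))}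
      (Possible-uniform (List.lose (∈-choices⁺ (p∩q⊆q T (block k′ k)))
    (fillEdge-possible k ks (e ∪ image σ O) (reduce O a) ks< T<′ e′≡ a′≡))))))
    where
    lo = 0ℤ ⊔ (ν k ℤ.- + ∣ e ∣)
    hi = (+ ∣ T ∣ ℤ.- + ∣ e ∣) ⊓ (+ k ℤ.- + k′)
    O = T ∩ block k′ k
    k′≤k = ℕ.<⇒≤ k′<k

    -- Both interval bounds containing `∣ e ∣` come down to this count: the lower one becomes `ν≤`,
    -- the upper one says that a part of `T` is no larger than `T`.
    ∣e∣+∣O∣ : ∣ e ∣ ℕ.+ ∣ O ∣ ≡ ∣ T ∩ block 0 k ∣
    ∣e∣+∣O∣ = trans
      (cong (ℕ._+ ∣ O ∣) (trans (cong ∣_∣ e≡) (∣image∣ σ (T ∩ block 0 k′))))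
      (sym (∣∩-block∣ T k′≤k))

    lo≤∣O∣ : lo ℤ.≤ + ∣ O ∣
    lo≤∣O∣ = ℤ.⊔-lub (ℤ.+≤+ z≤n)
      (j≤i+k⇒j-i≤k (+ ∣ e ∣) (subst (λ m → ν k ℤ.≤ + m) (sym ∣e∣+∣O∣) (ν≤ k)))

    ∣O∣≤hi : + ∣ O ∣ ℤ.≤ hi
    ∣O∣≤hi = ℤ.⊓-glb
      (i+k≤j⇒k≤j-i (+ ∣ e ∣) (ℤ.+≤+
        (subst (ℕ._≤ ∣ T ∣) (sym ∣e∣+∣O∣) (∣p∩q∣≤∣p∣ T (block 0 k)))))
      (i+k≤j⇒k≤j-i (+ k′) (ℤ.+≤+ (begin
        k′ ℕ.+ ∣ O ∣                ≤⟨ ℕ.+-monoʳ-≤ k′ (∣p∩q∣≤∣q∣ T (block k′ k)) ⟩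
        k′ ℕ.+ ∣ block {n} k′ k ∣   ≤⟨ ℕ.+-monoʳ-≤ k′ (∣block∣≤ n k′≤k) ⟩
        k′ ℕ.+ (k ℕ.∸ k′)           ≡⟨ ℕ.m+[n∸m]≡n k′≤k ⟩
        k                           ∎)))
      where open ℕ.≤-Reasoning

    T<′ : ∀ {p} → p ∈ T → Any (toℕ p ℕ.<_) (k ∷ ks)
    T<′ p∈T with T< p∈T
    -- Positions before `k′` are also before `k`, so `k` can take over as the last index handled.
    ... | here p<k′  = here (ℕ.<-trans p<k′ k′<k)
    ... | there p<ks = p<ks

    e′≡ : e ∪ image σ O ≡ image σ (T ∩ block 0 k)
    e′≡ = begin
      e ∪ image σ O                           ≡⟨ cong (_∪ image σ O) e≡ ⟩
      image σ (T ∩ block 0 k′) ∪ image σ O    ≡⟨ image-∪ σ (T ∩ block 0 k′) O ⟨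
      image σ ((T ∩ block 0 k′) ∪ O)          ≡⟨ cong (image σ) (∩-block-∪ T k′≤k) ⟩
      image σ (T ∩ block 0 k)                 ∎
      where open ≡-Reasoning

    a′≡ : ∀ p → reduce O a p ≡ reduce (T ∩ block 0 k) a₀ p
    a′≡ p = begin
      reduce O a p
        ≡⟨ reduce-cong O a≡ p ⟩
      reduce O (reduce (T ∩ block 0 k′) a₀) p
        ≡⟨ reduce-∪ (T ∩ block 0 k′) O (∩-block-disjoint T k′ k) a₀ p ⟩
      reduce ((T ∩ block 0 k′) ∪ O) a₀ p
        ≡⟨ cong (λ S → reduce S a₀ p) (∩-block-∪ T k′≤k) ⟩
      reduce (T ∩ block 0 k) a₀ p
        ∎
      where open ≡-Reasoning

-- The leading 0 is the convention for the index before the first critical one; it is strictly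
-- smaller because the candidates start at 1.
criticalIndices-ascending : ∀ (a : DegreeSequence n) bs →
                            AllPairs ℕ._<_ (0 ∷ criticalIndices a bs)
criticalIndices-ascending {n} a bs =
  All.filter⁺ (critical? a bs) (All.map⁺ (All.universal (λ _ → s≤s z≤n) (upTo n))) ∷
  AllPairs.filter⁺ (critical? a bs)
    (AllPairs.map⁺ (AllPairs.applyUpTo⁺₁ (λ i → i) n (λ i<j _ → s≤s i<j)))

-- The candidates run from 1 to `n`, so `n` is one of them only if it is nonzero.
n∈criticalIndices : ∀ {n} .{{_ : ℕ.NonZero n}} (a : DegreeSequence n) bs →
                    Critical a bs n → n List.∈ criticalIndices a bs
n∈criticalIndices {suc _} a bs = ∈-filter⁺ (critical? a bs) (∈-map⁺ suc (∈-upTo⁺ ℕ.≤-refl))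

-- Producing the next edge of a given hypergraph

module _ (σ : Permutation′ n) (e : Subset n) (H : Hypergraph n) (a : DegreeSequence n)
         (a≡ : ∀ p → a p ≡ + degree (e ∷ H) (σ ⟨$⟩ʳ p)) where

  private
    T : Subset n
    T = image (Perm.flip σ) e

    d : DegreeSequence n
    d p = + degree H (σ ⟨$⟩ʳ p)

    -- The dimension of `e` is left out: margins compare with the conjugate of the remaining
    -- dimensions.
    bs : List ℕ
    bs = map ∣_∣ H

  partialSum-split : ∀ k → partialSum k a ≡ + ∣ T ∩ block 0 k ∣ ℤ.+ partialSum k d
  partialSum-split k = trans (partialSum-cong k a≡) (partialSum-degree-∷ k σ e H)

  margin≤ : ∀ k → margin a bs k ℤ.≤ + ∣ T ∩ block 0 k ∣
  margin≤ k = j≤i+k⇒j-i≤k c (begin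
    partialSum k a                 ≡⟨ partialSum-split k ⟩
    t ℤ.+ partialSum k d           ≤⟨ ℤ.+-monoʳ-≤ t (degree≤conjugate k σ H) ⟩
    t ℤ.+ c                        ≡⟨ ℤ.+-comm t c ⟩
    c ℤ.+ t                        ∎)
    where
    open ℤ.≤-Reasoning
    t = + ∣ T ∩ block 0 k ∣
    c = partialSum {n} k (conjugate bs)

  n-critical : ∀ {p} → p ∈ T → Critical a bs n
  n-critical p∈T = begin-strict
    partialSum {n} n (conjugate bs)
      ≤⟨ conjugate≤degree σ H ⟩
    partialSum n d
      ≡⟨ ℤ.+-identityˡ (partialSum n d) ⟨
    0ℤ ℤ.+ partialSum n d
      -- Removing the element `p` makes `T` strictly smaller, so `T` has positive size.
      <⟨ ℤ.+-monoˡ-< (partialSum n d) (ℤ.+<+ (ℕ.≤-<-trans z≤n (x∈p⇒∣p-x∣<∣p∣ p∈T))) ⟩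
    + ∣ T ∣ ℤ.+ partialSum n d
      ≡⟨ cong (λ S → + ∣ S ∣ ℤ.+ partialSum n d) (∩-block-full T n (λ {p} _ → toℕ<n p)) ⟨
    + ∣ T ∩ block 0 n ∣ ℤ.+ partialSum n d
      ≡⟨ partialSum-split n ⟨
    partialSum n a
      ∎
    where open ℤ.≤-Reasoning

  -- After the edge `e` is taken, the assumption on `a` holds again with `H` in place of `e ∷ H`.
  reduce≡ : ∀ p → reduce T a p ≡ d p
  reduce≡ p = begin
    reduce T a p                  ≡⟨ reduce-χ T a p ⟩
    a p ℤ.- χ T p                 ≡⟨ cong (ℤ._- χ T p) (trans (a≡ p) (degree-∷ σ e H p)) ⟩
    χ T p ℤ.+ d p ℤ.- χ T p       ≡⟨ xyx⁻¹≈y (χ T p) (d p) ⟩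
    d p                           ∎
    where open ≡-Reasoning

  edge-possible :
    Possible (λ (e′ , a′) → e′ ≡ e × (∀ p → a′ p ≡ d p))
             (fillEdge ∣ e ∣ σ 0 (map (λ k → k , margin a bs k) (criticalIndices a bs)) ∅ a)
  -- `fillEdge-possible` is about an edge of dimension `∣ T ∣`, which equals `∣ e ∣`.
  edge-possible rewrite sym (∣image∣ (Perm.flip σ) e) =
    Any.map (λ (e′≡ , a′≡) → trans e′≡ (image-flip σ e) , λ p → trans (a′≡ p) (reduce≡ p))
      (fillEdge-possible σ T a (margin a bs) margin≤ 0 (criticalIndices a bs) ∅ a
        (criticalIndices-ascending a bs)
        -- A position in `T` shows both that `n` is nonzero and that it is critical, and every
        -- position lies before `n`. For empty `T` there is nothing to check.
        (λ {p} p∈T → there (List.lose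
          (n∈criticalIndices {{nonZeroIndex p}} a bs (n-critical p∈T)) (toℕ<n p)))
        (sym (trans (cong (image σ) (∩-block-empty T)) (image-∅ σ)))
        (λ p → sym (trans (cong (λ S → reduce S a p) (∩-block-empty T)) (reduce-∅ a p))))

-- Induction on the edges in their listed order, so the output equals `H` even as a list. The
-- assumption refers to the vertex at each position; sorting therefore just precomposes both of its
-- sides with the same permutation.
iterations-possible : ∀ (rule : SortingRule n) H σ a →
  (∀ p → a p ≡ + degree H (σ ⟨$⟩ʳ p)) →
  Possible (_≡ H) (iterations rule (map ∣_∣ H) σ a)
iterations-possible rule []      σ a a≡ = Possible-return refl
iterations-possible rule (e ∷ H) σ a a≡ =
  Possible->>= (Any.map (λ {x} → next {x}) (edge-possible σ e H a a≡))
  where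
  next : ∀ {((e′ , a′) , _) : (Subset _ × DegreeSequence _) × ℚ} →
    e′ ≡ e × (∀ p → a′ p ≡ + degree H (σ ⟨$⟩ʳ p)) →
    Possible (_≡ e ∷ H)
      (iterations rule (map ∣_∣ H) (order rule σ a′ ∘ₚ σ) (a′ ∘ (order rule σ a′ ⟨$⟩ʳ_))
        >>= λ H′ → return (e′ ∷ H′))
  next {(e′ , a′) , _} (refl , a′≡) = Possible->>=
    (Any.map (Possible-return ∘ cong (e ∷_))
      (iterations-possible rule H (order rule σ a′ ∘ₚ σ) _ (a′≡ ∘ (order rule σ a′ ⟨$⟩ʳ_))))

degree-↭ : ∀ {G H : Hypergraph n} → G ↭ H → ∀ v → degree G v ≡ degree H v
degree-↭ G↭H v = ↭-length (filter-↭ (v ∈?_) G↭H)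

theorem4 : ∀ {n m : ℕ} (rule : SortingRule n) (a : Vec ℕ n) (b : Vec ℕ m) →
    Antitonic₁ Fin._≤_ ℕ._≤_ (lookup a) →
    Antitonic₁ Fin._≤_ ℕ._≤_ (lookup b) →
    (H : Hypergraph n) → H Realises a , b →
    0ℚ ℚ.< Pr (_↭? H) (generate rule a b)
-- The algorithm handles dimensions in the order of `b`, so the edges of `H` are first rearranged
-- into a list `G` whose dimensions appear in that order. A run producing `G` outputs the same
-- multiset.
theorem4 rule a b _ _ H H-realises with ↭-map-inv ∣_∣ (_Realises_,_.dimensions H-realises)
... | G , b≡ , H↭G rewrite b≡ =
  Pr-positive (_↭? H) (AllPositive-iterations rule (map ∣_∣ G) Perm.id _)
    (Any.map (λ {refl → ↭-sym H↭G})
      (iterations-possible rule G Perm.id _ λ p →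
        cong +_ (trans (sym (_Realises_,_.degrees H-realises p)) (degree-↭ H↭G p))))
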